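{- Fix a positive integer $t$. Consider MRHS systems over $GF(q)$ $$A_iX\in\{b_{i_1},\ldots,b_{i_{s_i}}\},\qquad i=1,\ldots,m,$$ in a column $n$-vector $X$ of unknowns, where the matrices $A_i$ over $GF(q)$, of size $t_i\times n$ and rank $t_i$, are fixed, and the right-hand side sets are generated according to the probabilistic model described in the context. Suppose that $t_i\le t$ for all $i$ and that $n$ tends to infinity. Then the average complexity of solving the system is $$O\bigl(m\,q^{\,n-\lceil n/t\rceil}\bigr).$$
   Context: An MRHS (Multiple Right-Hand Sides) system over $GF(q)$ is a system of inclusions $A_iX\in S_i$, $i=1,\dots,m$, where $X$ is a column $n$-vector of unknowns over $GF(q)$, $A_i$ is a $t_i\times n$ matrix over $GF(q)$ of rank $t_i$, and $S_i=\{b_{i_1},\ldots,b_{i_{s_i}}\}$ is a set of column vectors in $GF(q)^{t_i}$. A solution is a vector $X_0$ satisfying all the inclusions. Probabilistic model: the matrices $A_i$ are fixed. For $i=1,\dots,m$, independently, a polynomial $g_i(y_1,\dots,y_{t_i})$ is chosen uniformly at random from all polynomials over $GF(q)$ of degree at most $q-1$ in each variable, and $S_i$ is the set of zeros of $g_i$ in $GF(q)^{t_i}$. Gluing: given two equations $A_1X\in S_1$ and $A_2X\in S_2$, gluing replaces them by one equation $AX\in S$ having as solutions exactly their common solutions. The matrix $A$ is obtained by writing $A_2$ under $A_1$ and eliminating dependent rows (so $A$ has $\mathrm{rank}(A_1,A_2)$ rows, where $\mathrm{rank}(A_1,A_2)$ is the rank of the set of all rows of $A_1$ and $A_2$), and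 $S$ is the set of vectors $b$ such that the linear system $AX=b$ is equivalent to $A_1X=b_1,\ A_2X=b_2$ for some $b_1\in S_1$, $b_2\in S_2$. Average complexity: the system is solved by successively gluing equations $1,2,\dots,m$ into a single equation. Let $S^{(k)}$ be the right-hand side set of the equation obtained by gluing the first $k$ equations (with $S^{(1)}=S_1$). The average complexity is measured, up to a constant factor, by the sum of the average numbers of right-hand sides, $\sum_{k=1}^m \mathbb{E}|S^{(k)}|$. The cost of solving the final equation $AX\in S$ as $|S|$ ordinary linear systems is neglected. -}

module Defs where

open import Algebra.Apartness.Structures using (IsHeytingField)
import Algebra.Properties.Monoid.Sum as MonoidSum
open import Data.Fin.Base using (Fin; zero; suc; inject₁)
import Data.Fin.Properties as Fin
open import Data.Integer.Base using (+_)
open import Data.List.Base as List using (List; []; _∷_; cartesianProductWith; allFin)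
open import Data.List.Membership.Propositional using (_∈_; lose)
open import Data.List.Membership.Propositional.Properties
  using (∈-allFin; ∈-map⁺; ∈-cartesianProductWith⁺)
open import Data.List.Relation.Unary.All as All using ()
open import Data.List.Relation.Unary.Any as Any using (here)
open import Data.Nat.Base using (ℕ; zero; suc; pred; _≤_; NonZero)
import Data.Nat.Base as ℕ
open import Data.Nat.DivMod using (_/_)
open import Data.Nat.ListAction using (sum)
open import Data.Product.Base using (∃; ∃-syntax; Σ-syntax; _×_; _,_; proj₁; proj₂)
open import Data.Rational.Base as ℚ using (ℚ)
open import Data.Rational.Properties using (+-0-monoid)
open import Data.Vec.Base as Vec using (Vec; []; _∷_; _++_)
open import Data.Vec.Properties using (≡-dec)
open import Function.Base using (_∘_)
open import Function.Bundles using (Inverse; Equivalence; _↔_; _⇔_; mk⇔)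
open import Function.Definitions using (Injective)
open import Function.Properties.Inverse using (↔⇒↣)
open import Level using (0ℓ)
open import Relation.Binary.Definitions using (DecidableEquality)
open import Relation.Binary.PropositionalEquality
  using (_≡_; _≢_; refl; subst)
open import Relation.Nullary.Decidable as Dec using (Dec; yes; no; _×-dec_; _→-dec_)
open import Relation.Unary using (Pred; Decidable)

⌈_/_⌉ : (n t : ℕ) .{{_ : NonZero t}} → ℕ
⌈ n / t ⌉ = (n ℕ.+ pred t) / t

module _ {A : Set} where

  allVecs : List A → ∀ n → List (Vec A n)
  allVecs xs zero    = [] ∷ []
  allVecs xs (suc n) = cartesianProductWith _∷_ xs (allVecs xs n)

  ∈-allVecs : ∀ {xs} → (∀ x → x ∈ xs) → ∀ {n} (v : Vec A n) → v ∈ allVecs xs n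
  ∈-allVecs ∈xs []      = here refl
  ∈-allVecs ∈xs (x ∷ v) = ∈-cartesianProductWith⁺ _∷_ (∈xs x) (∈-allVecs ∈xs v)

  ∈⇒length≢0 : ∀ {x : A} {xs} → x ∈ xs → NonZero (List.length xs)
  ∈⇒length≢0 {xs = _ ∷ _} _ = _

  -- Expected value of f at a uniformly random entry of a list; the entries
  -- of the list are taken to be the equally likely outcomes.
  𝔼 : (Ω : List A) .{{_ : NonZero (List.length Ω)}} → (A → ℕ) → ℚ
  𝔼 Ω f = + sum (List.map f Ω) ℚ./ List.length Ω

∑ : ∀ {m} → (Fin m → ℚ) → ℚ
∑ = MonoidSum.sum +-0-monoid

-- Since equality is decidable on a finite carrier, ≢ is the apartness of a
-- discrete field: every x ≢ 0# is invertible, and 0# ≢ 1#.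
record FiniteField (q : ℕ) : Set₁ where
  infixl 6 _+_
  infixl 7 _*_
  field
    Carrier        : Set
    _+_ _*_        : Carrier → Carrier → Carrier
    -_             : Carrier → Carrier
    0# 1#          : Carrier
    isHeytingField : IsHeytingField _≡_ _≢_ _+_ _*_ -_ 0# 1#
    enumeration    : Carrier ↔ Fin q

module MRHS {q : ℕ} (F : FiniteField q) where

  open FiniteField F

  infix 4 _≟_ _≟ᵛ_

  _≟_ : DecidableEquality Carrier
  _≟_ = Fin.inj⇒≟ (↔⇒↣ enumeration)

  _≟ᵛ_ : ∀ {n} → DecidableEquality (Vec Carrier n)
  _≟ᵛ_ = ≡-dec _≟_

  elements : List Carrier
  elements = List.map (Inverse.from enumeration) (allFin q)

  ∈-elements : ∀ x → x ∈ elements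
  ∈-elements x = subst (_∈ elements) (Inverse.strictlyInverseʳ enumeration x)
    (∈-map⁺ (Inverse.from enumeration) (∈-allFin (Inverse.to enumeration x)))

  vectors : ∀ n → List (Vec Carrier n)
  vectors = allVecs elements

  ∃? : ∀ {n} {P : Pred (Vec Carrier n) 0ℓ} → Decidable P → Dec (∃ P)
  ∃? P? = Dec.map′ Any.satisfied
    (λ (v , Pv) → lose (∈-allVecs ∈-elements v) Pv) (Any.any? P? (vectors _))

  ∀? : ∀ {n} {P : Pred (Vec Carrier n) 0ℓ} → Decidable P → Dec (∀ v → P v)
  ∀? P? = Dec.map′ (λ all v → All.lookup all (∈-allVecs ∈-elements v))
    (λ ∀P → All.universal ∀P _) (All.all? P? (vectors _))

  _⇔-dec_ : ∀ {A B : Set} → Dec A → Dec B → Dec (A ⇔ B)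
  A? ⇔-dec B? = Dec.map′ (λ (f , g) → mk⇔ f g)
    (λ e → Equivalence.to e , Equivalence.from e)
    ((A? →-dec B?) ×-dec (B? →-dec A?))

  -- A t × n matrix is the vector of its rows.
  Matrix : ℕ → ℕ → Set
  Matrix t n = Vec (Vec Carrier n) t

  0ᵛ : ∀ {n} → Vec Carrier n
  0ᵛ = Vec.replicate _ 0#

  dot : ∀ {n} → Vec Carrier n → Vec Carrier n → Carrier
  dot u v = Vec.foldr′ _+_ 0# (Vec.zipWith _*_ u v)

  infixr 7 _·_

  _·_ : ∀ {t n} → Matrix t n → Vec Carrier n → Vec Carrier t
  A · X = Vec.map (λ row → dot row X) A

  combination : ∀ {t n} → Vec Carrier t → Matrix t n → Vec Carrier n
  combination []       []       = 0ᵛ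
  combination (c ∷ cs) (a ∷ as) =
    Vec.zipWith _+_ (Vec.map (c *_) a) (combination cs as)

  InSpan : ∀ {t n} → Matrix t n → Pred (Vec Carrier n) 0ℓ
  InSpan A v = ∃[ c ] combination c A ≡ v

  InSpan? : ∀ {t n} (A : Matrix t n) → Decidable (InSpan A)
  InSpan? A v = ∃? λ c → combination c A ≟ᵛ v

  LinearlyIndependent : ∀ {t n} → Matrix t n → Set
  LinearlyIndependent A = ∀ c → combination c A ≡ 0ᵛ → c ≡ 0ᵛ

  HasIndependentRows : ∀ {t n} → Matrix t n → ℕ → Set
  HasIndependentRows {t} A r = Σ[ s ∈ (Fin r → Fin t) ]
    Injective _≡_ _≡_ s × LinearlyIndependent (Vec.tabulate (Vec.lookup A ∘ s))

  HasRank : ∀ {t n} → Matrix t n → ℕ → Set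
  HasRank A r = HasIndependentRows A r × (∀ r′ → HasIndependentRows A r′ → r′ ≤ r)

  -- Deletes every row that depends linearly on the retained rows below it.
  -- The retained rows are independent and span the same space.
  eliminate : ∀ {t n} → Matrix t n → ∃[ r ] Matrix r n
  eliminate []      = 0 , []
  eliminate (a ∷ A) with eliminate A
  ... | r , B with InSpan? B a
  ...   | yes _ = r , B
  ...   | no  _ = suc r , a ∷ B

  record Equation (n : ℕ) : Set₁ where
    field
      {rows} : ℕ
      A      : Matrix rows n
      S      : Pred (Vec Carrier rows) 0ℓ
      S?     : Decidable S

    ∣S∣ : ℕ
    ∣S∣ = List.length (List.filter S? (vectors rows))

  glue : ∀ {n} → Equation n → Equation n → Equation n
  glue {n} E₁ E₂ = record
    { A  = A
    ; S  = λ b → ∃[ b₁ ] ∃[ b₂ ] E₁.S b₁ × E₂.S b₂ × (∀ X →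
             A · X ≡ b ⇔ (E₁.A · X ≡ b₁ × E₂.A · X ≡ b₂))
    ; S? = λ b → ∃? λ b₁ → ∃? λ b₂ → E₁.S? b₁ ×-dec E₂.S? b₂ ×-dec (∀? λ X →
             (A · X ≟ᵛ b) ⇔-dec ((E₁.A · X ≟ᵛ b₁) ×-dec (E₂.A · X ≟ᵛ b₂)))
    }
    where
    module E₁ = Equation E₁
    module E₂ = Equation E₂
    A : Matrix (proj₁ (eliminate (E₁.A ++ E₂.A))) n
    A = proj₂ (eliminate (E₁.A ++ E₂.A))

  -- The result of gluing equations 0, 1, …, k, in this order, one at a time.
  glueUpTo : ∀ {m n} → (Fin m → Equation n) → Fin m → Equation n
  glueUpTo E zero    = E zero
  glueUpTo E (suc k) = glue (glueUpTo (E ∘ inject₁) k) (E (suc k))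

  -- Polynomials in t variables of degree at most q - 1 in each variable.  In
  -- t + 1 variables: the q coefficients, lowest first, of the powers of the
  -- first variable, each a polynomial in the other t variables.
  Poly : ℕ → Set
  Poly zero    = Carrier
  Poly (suc t) = Vec (Poly t) q

  eval : ∀ {t} → Poly t → Vec Carrier t → Carrier
  eval {zero}  c []       = c
  eval {suc t} g (y ∷ ys) = Vec.foldr′ (λ c acc → eval c ys + y * acc) 0# g

  polys : ∀ t → List (Poly t)
  polys zero    = elements
  polys (suc t) = allVecs (polys t) q

  ∈-polys : ∀ t (g : Poly t) → g ∈ polys t
  ∈-polys zero    = ∈-elements
  ∈-polys (suc t) = ∈-allVecs (∈-polys t)

  0ᵖ : ∀ t → Poly t
  0ᵖ zero    = 0#
  0ᵖ (suc t) = Vec.replicate q (0ᵖ t)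

  -- All families (g₁ , … , gₘ) of polynomials, each listed once: drawing
  -- uniformly from this list draws the gᵢ uniformly and independently.
  outcomes : ∀ {m} (t : Fin m → ℕ) → List (∀ i → Poly (t i))
  outcomes {zero}  t = (λ ()) ∷ []
  outcomes {suc m} t =
    cartesianProductWith Fin.∀-cons (polys (t zero)) (outcomes (t ∘ suc))

  outcomes-nonempty : ∀ {m} (t : Fin m → ℕ) → ∃[ g ] g ∈ outcomes t
  outcomes-nonempty {zero}  t = _ , here refl
  outcomes-nonempty {suc m} t = _ , ∈-cartesianProductWith⁺ Fin.∀-cons
    (∈-polys (t zero) (0ᵖ (t zero))) (proj₂ (outcomes-nonempty (t ∘ suc)))

  outcomes-nonZero : ∀ {m} (t : Fin m → ℕ) → NonZero (List.length (outcomes t))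
  outcomes-nonZero t = ∈⇒length≢0 (proj₂ (outcomes-nonempty t))

  zeroSetEquation : ∀ {t n} → Matrix t n → Poly t → Equation n
  zeroSetEquation A g = record
    { A  = A
    ; S  = λ y → eval g y ≡ 0#
    ; S? = λ y → eval g y ≟ 0#
    }

  module _ {m n : ℕ} {t : Fin m → ℕ} (A : ∀ i → Matrix (t i) n) where

    -- The number of right-hand sides after gluing equations 0, …, k, when
    -- the right-hand side sets are the zero sets of the polynomials g.
    gluedSize : Fin m → (∀ i → Poly (t i)) → ℕ
    gluedSize k g = Equation.∣S∣ (glueUpTo (λ i → zeroSetEquation (A i) (g i)) k)

    averageComplexity : ℚ
    averageComplexity = ∑ λ k → 𝔼 (outcomes t) {{outcomes-nonZero t}} (gluedSize k)

{-# OPTIONS --safe #-}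
module Submission where

-- Write r for the number of rows of the matrix A obtained by gluing the first
-- k equations.  These rows are independent, so every b equals A X for some
-- X = X(b), whence qʳ ≤ qⁿ.  If b is a glued right-hand side, then
-- gᵢ(Aᵢ X(b)) = 0 for all i ≤ k.  The point Aᵢ X(b) does not depend on g, and a
-- random polynomial vanishes at a given point with probability 1/q (look at
-- its constant coefficient).  Hence the average number of right-hand sides is
-- at most qʳ⁻ᵏ, where r ≤ n and r ≤ k t, and both for k < ⌈n/t⌉ and for
-- k ≥ ⌈n/t⌉ this gives r - k ≤ n - ⌈n/t⌉.

open import Defs
open import Algebra.Apartness.Structures using (IsHeytingField)
open import Algebra.Bundles using (CommutativeRing)
import Algebra.Properties.CommutativeSemigroup as CommutativeSemigroupProperties
import Algebra.Properties.Group as GroupProperties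
import Algebra.Properties.Ring as RingProperties
open import Data.Fin.Base as Fin
  using (Fin; zero; suc; toℕ; inject₁; punchOut; funToFin; finToFun)
import Data.Fin.Properties as Fin
open import Data.Integer.Base using (+_)
import Data.Integer.Base as ℤ
import Data.Integer.Properties as ℤ
open import Data.List.Base
  using (List; []; _∷_; map; length; filter; cartesianProductWith; allFin)
  renaming (_++_ to _++ₗ_)
open import Data.List.Properties using (map-++; map-∘; length-map; length-tabulate)
open import Data.List.Relation.Unary.All as All using (All; []; _∷_)
open import Data.List.Relation.Unary.AllPairs using ([]; _∷_)
open import Data.List.Relation.Unary.Unique.Propositional using (Unique)
import Data.List.Relation.Unary.Unique.Propositional.Properties as Unique
open import Data.Nat.Base using (ℕ; zero; suc; NonZero; _≤_; _*_; _^_; _∸_; z≤n; s≤s)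
import Data.Nat.Base as ℕ
open import Data.Nat.DivMod using (m/n*n≤m)
open import Data.Nat.ListAction using (sum)
open import Data.Nat.ListAction.Properties using (sum-++)
import Data.Nat.Properties as ℕ
open import Data.Product.Base using (∃-syntax; _×_; _,_; proj₁; proj₂)
open import Data.Rational.Base as ℚ using ()
import Data.Rational.Properties as ℚ
import Data.Rational.Unnormalised.Base as ℚᵘ
import Data.Rational.Unnormalised.Properties as ℚᵘ
open import Data.Sum.Base using (_⊎_; inj₁; inj₂)
open import Data.Vec.Base as Vec using (Vec; []; _∷_; lookup; tabulate; zipWith; replicate)
import Data.Vec.Properties as Vec
open import Function.Base using (_∘_; const)
open import Function.Bundles using (Equivalence; Inverse)
open import Function.Definitions using (Injective)
open import Relation.Binary.PropositionalEquality
open import Relation.Nullary.Decidable using (Dec; yes; no; _×-dec_; ¬?; decidable-stable)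
open import Relation.Nullary.Negation using (¬_; contradiction)
open import Relation.Unary using (Pred; Decidable)

-- Finite sums and finite index sets.

indicator : ∀ {p} {P : Set p} → Dec P → ℕ
indicator (yes _) = 1
indicator (no _)  = 0

indicator-mono : ∀ {p q} {P : Set p} {Q : Set q} (P? : Dec P) (Q? : Dec Q) →
                 (P → Q) → indicator P? ≤ indicator Q?
indicator-mono (yes p) (yes q) f = ℕ.≤-refl
indicator-mono (yes p) (no ¬q) f = contradiction (f p) ¬q
indicator-mono (no ¬p) Q?      f = z≤n

indicator-≤ : ∀ {p} {P : Set p} (P? : Dec P) {m} → (P → 1 ≤ m) → indicator P? ≤ m
indicator-≤ (yes p) f = f p
indicator-≤ (no ¬p) f = z≤n

1≤indicator : ∀ {p} {P : Set p} (P? : Dec P) → P → 1 ≤ indicator P?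
1≤indicator (yes _) p = ℕ.≤-refl
1≤indicator (no ¬p) p = contradiction p ¬p

module _ {a} {A : Set a} where

  sumOf : (A → ℕ) → List A → ℕ
  sumOf f xs = sum (map f xs)

  sumOf-mono : ∀ {f g} → (∀ x → f x ≤ g x) → ∀ xs → sumOf f xs ≤ sumOf g xs
  sumOf-mono f≤g []       = z≤n
  sumOf-mono f≤g (x ∷ xs) = ℕ.+-mono-≤ (f≤g x) (sumOf-mono f≤g xs)

  sumOf-const : ∀ c xs → sumOf (const c) xs ≡ length xs * c
  sumOf-const c []       = refl
  sumOf-const c (x ∷ xs) = cong (c ℕ.+_) (sumOf-const c xs)

  sumOf-+ : ∀ f g xs → sumOf (λ x → f x ℕ.+ g x) xs ≡ sumOf f xs ℕ.+ sumOf g xs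
  sumOf-+ f g []       = refl
  sumOf-+ f g (x ∷ xs) = trans (cong (f x ℕ.+ g x ℕ.+_) (sumOf-+ f g xs))
    (CommutativeSemigroupProperties.interchange ℕ.+-commutativeSemigroup (f x) (g x) _ _)

  sumOf-*ʳ : ∀ f c xs → sumOf f xs * c ≡ sumOf (λ x → f x * c) xs
  sumOf-*ʳ f c []       = refl
  sumOf-*ʳ f c (x ∷ xs) = trans (ℕ.*-distribʳ-+ c (f x) _)
    (cong (f x * c ℕ.+_) (sumOf-*ʳ f c xs))

  sumOf-*ˡ : ∀ c f xs → sumOf (λ x → c * f x) xs ≡ c * sumOf f xs
  sumOf-*ˡ c f []       = sym (ℕ.*-zeroʳ c)
  sumOf-*ˡ c f (x ∷ xs) = trans (cong (c * f x ℕ.+_) (sumOf-*ˡ c f xs))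
    (sym (ℕ.*-distribˡ-+ c (f x) _))

  -- Probability bounds are kept with denominators cleared: `f x * c ≤ d` reads as `f x / d` being
  -- at most `1 / c`. Division is thus postponed until the final passage to ℚ.
  sumOf-*-≤ : ∀ {f c d} → (∀ x → f x * c ≤ d) → ∀ xs → sumOf f xs * c ≤ length xs * d
  sumOf-*-≤ {f} {c} {d} fc≤d xs = begin
    sumOf f xs * c             ≡⟨ sumOf-*ʳ f c xs ⟩
    sumOf (λ x → f x * c) xs   ≤⟨ sumOf-mono fc≤d xs ⟩
    sumOf (const d) xs         ≡⟨ sumOf-const d xs ⟩
    length xs * d              ∎
    where open ℕ.≤-Reasoning

  length-filter≡sumOf : ∀ {p} {P : Pred A p} (P? : Decidable P) xs →
                        length (filter P? xs) ≡ sumOf (indicator ∘ P?) xs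
  length-filter≡sumOf P? []       = refl
  length-filter≡sumOf P? (x ∷ xs) with P? x
  ... | yes _ = cong suc (length-filter≡sumOf P? xs)
  ... | no  _ = length-filter≡sumOf P? xs

  sumOf-indicator-none : ∀ {p} {P : Pred A p} (P? : Decidable P) {xs} →
                         All (¬_ ∘ P) xs → sumOf (indicator ∘ P?) xs ≡ 0
  sumOf-indicator-none P? []         = refl
  sumOf-indicator-none P? {x ∷ _} (¬px ∷ ¬p) with P? x
  ... | yes px = contradiction px ¬px
  ... | no  _  = sumOf-indicator-none P? ¬p

  sumOf-indicator-unique : ∀ {p} {P : Pred A p} (P? : Decidable P) →
                           (∀ {x y} → P x → P y → x ≡ y) →
                           ∀ {xs} → Unique xs → sumOf (indicator ∘ P?) xs ≤ 1
  sumOf-indicator-unique P? P! []           = z≤n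
  sumOf-indicator-unique P? P! {x ∷ xs} (x∉xs ∷ xs!) with P? x
  ... | yes px = ℕ.≤-reflexive (cong suc
                   (sumOf-indicator-none P? (All.map (λ x≢y py → x≢y (P! px py)) x∉xs)))
  ... | no  _  = sumOf-indicator-unique P? P! xs!

module _ {a b} {A : Set a} {B : Set b} where

  sumOf-swap : ∀ (f : A → B → ℕ) xs ys →
    sumOf (λ x → sumOf (f x) ys) xs ≡ sumOf (λ y → sumOf (λ x → f x y) xs) ys
  sumOf-swap f []       ys = sym (trans (sumOf-const 0 ys) (ℕ.*-zeroʳ (length ys)))
  sumOf-swap f (x ∷ xs) ys = trans (cong (sumOf (f x) ys ℕ.+_) (sumOf-swap f xs ys))
    (sym (sumOf-+ (f x) (λ y → sumOf (λ z → f z y) xs) ys))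

  -- The counting form of independence: it separates the draw of the first polynomial from the draws
  -- of the remaining ones.
  sumOf-product : ∀ (f : A → ℕ) (g : B → ℕ) xs ys →
    sumOf (λ x → sumOf (λ y → f x * g y) ys) xs ≡ sumOf f xs * sumOf g ys
  sumOf-product f g []       ys = refl
  sumOf-product f g (x ∷ xs) ys = begin
    sumOf (λ y → f x * g y) ys ℕ.+ sumOf (λ x → sumOf (λ y → f x * g y) ys) xs
      ≡⟨ cong₂ ℕ._+_ (sumOf-*ˡ (f x) g ys) (sumOf-product f g xs ys) ⟩
    f x * sumOf g ys ℕ.+ sumOf f xs * sumOf g ys
      ≡⟨ ℕ.*-distribʳ-+ (sumOf g ys) (f x) (sumOf f xs) ⟨
    (f x ℕ.+ sumOf f xs) * sumOf g ys ∎
    where open ≡-Reasoning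

  module _ {c} {C : Set c} where

    sumOf-cartesianProductWith : ∀ (f : A → B → C) h xs ys →
      sumOf h (cartesianProductWith f xs ys) ≡ sumOf (λ x → sumOf (h ∘ f x) ys) xs
    sumOf-cartesianProductWith f h []       ys = refl
    sumOf-cartesianProductWith f h (x ∷ xs) ys = begin
      sum (map h (map (f x) ys ++ₗ rest))
        ≡⟨ cong sum (map-++ h (map (f x) ys) rest) ⟩
      sum (map h (map (f x) ys) ++ₗ map h rest)
        ≡⟨ sum-++ (map h (map (f x) ys)) (map h rest) ⟩
      sum (map h (map (f x) ys)) ℕ.+ sumOf h rest
        ≡⟨ cong₂ ℕ._+_ (cong sum (sym (map-∘ ys))) (sumOf-cartesianProductWith f h xs ys) ⟩
      sumOf (h ∘ f x) ys ℕ.+ sumOf (λ x → sumOf (h ∘ f x) ys) xs ∎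
      where
      open ≡-Reasoning
      rest = cartesianProductWith f xs ys

    length-cartesianProductWith : ∀ (f : A → B → C) xs ys →
      length (cartesianProductWith f xs ys) ≡ length xs * length ys
    length-cartesianProductWith f xs ys = begin
      length zs                                  ≡⟨ ℕ.*-identityʳ _ ⟨
      length zs * 1                              ≡⟨ sumOf-const 1 zs ⟨
      sumOf (const 1) zs                         ≡⟨ sumOf-cartesianProductWith f (const 1) xs ys ⟩
      sumOf (λ _ → sumOf (const 1) ys) xs        ≡⟨ sumOf-const _ xs ⟩
      length xs * sumOf (const 1) ys             ≡⟨ cong (length xs *_) (sumOf-const 1 ys) ⟩
      length xs * (length ys * 1)                ≡⟨ cong (length xs *_) (ℕ.*-identityʳ _) ⟩
      length xs * length ys                      ∎
      where
      open ≡-Reasoning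
      zs = cartesianProductWith f xs ys

length-allVecs : ∀ {A : Set} (xs : List A) n → length (allVecs xs n) ≡ length xs ^ n
length-allVecs xs zero    = refl
length-allVecs xs (suc n) = trans (length-cartesianProductWith _∷_ xs (allVecs xs n))
  (cong (length xs *_) (length-allVecs xs n))

-- Otherwise punching i out of the codomain would give an injection from
-- Fin (suc n) to Fin n.
injective⇒surjective : ∀ {n} {f : Fin n → Fin n} → Injective _≡_ _≡_ f → ∀ i → ∃[ j ] f j ≡ i
injective⇒surjective {suc n} {f} f-injective i with Fin.any? (λ j → f j Fin.≟ i)
... | yes found = found
... | no ¬found = contradiction
  (Fin.injective⇒≤ {f = λ j → punchOut (i≢f j)}
    (λ {j} {k} → f-injective ∘ Fin.punchOut-injective (i≢f j) (i≢f k)))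
  ℕ.1+n≰n
  where
  i≢f : ∀ j → i ≢ f j
  i≢f j i≡fj = ¬found (j , sym i≡fj)

-- Matches the recursion of `glueUpTo`, which reaches the earlier equations through `inject₁` and
-- splits off the last one as `suc k`.
≤suc⇒inject₁⊎≡ : ∀ {m} (i : Fin (suc m)) (k : Fin m) → i Fin.≤ suc k →
                 (∃[ j ] j Fin.≤ k × inject₁ j ≡ i) ⊎ i ≡ suc k
≤suc⇒inject₁⊎≡ {suc m} zero          k       _         = inj₁ (zero , z≤n , refl)
≤suc⇒inject₁⊎≡ {suc m} (suc zero)    zero    _         = inj₂ refl
≤suc⇒inject₁⊎≡ {suc m} (suc (suc i)) zero    (s≤s ())
≤suc⇒inject₁⊎≡ {suc m} (suc i)       (suc k) (s≤s i≤k) with ≤suc⇒inject₁⊎≡ i k i≤k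
... | inj₁ (j , j≤k , refl) = inj₁ (suc j , s≤s j≤k , refl)
... | inj₂ refl             = inj₂ refl

-- Bounds on rational averages.

-- Since `ℚ./` reduces fractions, the comparison is transported to unnormalised rationals, where it
-- is plain cross-multiplication.
/-≤ : ∀ a N d .{{_ : NonZero d}} → a ≤ N * d → + a ℚ./ d ℚ.≤ + N ℚ./ 1
/-≤ a N (suc d) a≤Nd = ℚ.toℚᵘ-cancel-≤ (begin
  ℚ.toℚᵘ (+ a ℚ./ suc d)   ≃⟨ ℚ.toℚᵘ-fromℚᵘ (ℚᵘ.mkℚᵘ (+ a) d) ⟩
  ℚᵘ.mkℚᵘ (+ a) d          ≤⟨ ℚᵘ.*≤* a*1≤N*d ⟩
  ℚᵘ.mkℚᵘ (+ N) 0          ≃⟨ ℚ.toℚᵘ-fromℚᵘ (ℚᵘ.mkℚᵘ (+ N) 0) ⟨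
  ℚ.toℚᵘ (+ N ℚ./ 1)       ∎)
  where
  open ℚᵘ.≤-Reasoning
  a*1≤N*d : + a ℤ.* + 1 ℤ.≤ + N ℤ.* + suc d
  a*1≤N*d = subst₂ ℤ._≤_ (sym (ℤ.*-identityʳ (+ a))) (ℤ.pos-* N (suc d)) (ℤ.+≤+ a≤Nd)

+/1-homo : ∀ a b → (+ a ℚ./ 1) ℚ.+ (+ b ℚ./ 1) ≡ + (a ℕ.+ b) ℚ./ 1
+/1-homo a b = ℚ.toℚᵘ-injective (begin
  ℚ.toℚᵘ ((+ a ℚ./ 1) ℚ.+ (+ b ℚ./ 1))
    ≈⟨ ℚ.toℚᵘ-homo-+ (+ a ℚ./ 1) (+ b ℚ./ 1) ⟩
  ℚ.toℚᵘ (+ a ℚ./ 1) ℚᵘ.+ ℚ.toℚᵘ (+ b ℚ./ 1)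
    ≈⟨ ℚᵘ.+-cong (ℚ.toℚᵘ-fromℚᵘ (ℚᵘ.mkℚᵘ (+ a) 0)) (ℚ.toℚᵘ-fromℚᵘ (ℚᵘ.mkℚᵘ (+ b) 0)) ⟩
  ℚᵘ.mkℚᵘ (+ a) 0 ℚᵘ.+ ℚᵘ.mkℚᵘ (+ b) 0
    ≈⟨ ℚᵘ.*≡* (cong (ℤ._* + 1) (cong₂ ℤ._+_ (ℤ.*-identityʳ (+ a)) (ℤ.*-identityʳ (+ b)))) ⟩
  ℚᵘ.mkℚᵘ (+ (a ℕ.+ b)) 0
    ≈⟨ ℚ.toℚᵘ-fromℚᵘ (ℚᵘ.mkℚᵘ (+ (a ℕ.+ b)) 0) ⟨
  ℚ.toℚᵘ (+ (a ℕ.+ b) ℚ./ 1) ∎)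
  where open import Relation.Binary.Reasoning.Setoid ℚᵘ.≃-setoid

∑-≤ : ∀ {m N} {f : Fin m → ℚ.ℚ} → (∀ k → f k ℚ.≤ + N ℚ./ 1) → ∑ f ℚ.≤ + (m * N) ℚ./ 1
∑-≤ {zero}      f≤N = ℚ.≤-refl
∑-≤ {suc m} {N} f≤N = ℚ.≤-trans (ℚ.+-mono-≤ (f≤N zero) (∑-≤ (f≤N ∘ suc)))
  (ℚ.≤-reflexive (+/1-homo N (m * N)))

-- The exponent estimate.

⌈/⌉*≤ : ∀ n t .{{_ : NonZero t}} → ⌈ n / t ⌉ * t ≤ n ℕ.+ ℕ.pred t
⌈/⌉*≤ n t = m/n*n≤m (n ℕ.+ ℕ.pred t) t

-- Put c = ⌈n/t⌉. If c ≤ k, then n ≤ k + (n - c) and the second hypothesis suffices. If k < c, then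
-- r ≤ k + k (t - 1), and the ceiling gives k (t - 1) ≤ n - c. Comparing powers instead of exponents
-- avoids a logarithm, which would require q ≥ 2.
^-rank-bound : ∀ q .{{_ : NonZero q}} n t .{{_ : NonZero t}} k {r} →
               r ≤ k * t → q ^ r ≤ q ^ n →
               q ^ r ≤ q ^ k * q ^ (n ∸ ⌈ n / t ⌉)
^-rank-bound q n t@(suc s) k {r} r≤kt qʳ≤qⁿ =
  subst (q ^ r ≤_) (ℕ.^-distribˡ-+-* q k (n ∸ c)) (by-cases (ℕ.≤-<-connex c k))
  where
  open ℕ.≤-Reasoning
  c = ⌈ n / t ⌉

  -- Here `s` is t - 1. From k ≤ d - 1 follows k s + d ≤ (d - 1) s + d = d t - s ≤ n. The variable
  -- `d` stands for `c` so that it can be split as a successor.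
  k*s+c≤n : ∀ d → d * t ≤ n ℕ.+ s → k ℕ.< d → k * s ℕ.+ d ≤ n
  k*s+c≤n (suc d) ct≤n+s (s≤s k≤d) = ℕ.+-cancelʳ-≤ s _ _ (begin
    k * s ℕ.+ suc d ℕ.+ s        ≤⟨ ℕ.+-monoˡ-≤ s (ℕ.+-monoˡ-≤ (suc d) (ℕ.*-monoˡ-≤ s k≤d)) ⟩
    d * s ℕ.+ suc d ℕ.+ s        ≡⟨ ℕ.+-comm _ s ⟩
    s ℕ.+ (d * s ℕ.+ suc d)      ≡⟨ ℕ.+-assoc s (d * s) (suc d) ⟨
    suc d * s ℕ.+ suc d          ≡⟨ ℕ.+-comm (suc d * s) (suc d) ⟩
    suc d ℕ.+ suc d * s          ≡⟨ ℕ.*-suc (suc d) s ⟨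
    suc d * t                    ≤⟨ ct≤n+s ⟩
    n ℕ.+ s                      ∎)

  by-cases : c ≤ k ⊎ k ℕ.< c → q ^ r ≤ q ^ (k ℕ.+ (n ∸ c))
  by-cases (inj₁ c≤k) = begin
    q ^ r                  ≤⟨ qʳ≤qⁿ ⟩
    q ^ n                  ≤⟨ ℕ.^-monoʳ-≤ q (ℕ.m≤n+m∸n n c) ⟩
    q ^ (c ℕ.+ (n ∸ c))    ≤⟨ ℕ.^-monoʳ-≤ q (ℕ.+-monoˡ-≤ (n ∸ c) c≤k) ⟩
    q ^ (k ℕ.+ (n ∸ c))    ∎
  by-cases (inj₂ k<c) = ℕ.^-monoʳ-≤ q (begin
    r                      ≤⟨ r≤kt ⟩
    k * t                  ≡⟨ ℕ.*-suc k s ⟩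
    k ℕ.+ k * s            ≤⟨ ℕ.+-monoʳ-≤ k (ℕ.m+n≤o⇒m≤o∸n (k * s) (k*s+c≤n c (⌈/⌉*≤ n t) k<c)) ⟩
    k ℕ.+ (n ∸ c)          ∎)

module _ {q : ℕ} (F : FiniteField q) where

  open FiniteField F renaming (_*_ to _∙_)
  open MRHS F
  open IsHeytingField isHeytingField using (isCommutativeRing; #⇒invertible)

  private
    R : CommutativeRing _ _
    R = record { isCommutativeRing = isCommutativeRing }

  open CommutativeRing R using
    ( +-congˡ; +-assoc; +-comm; +-identityˡ; +-identityʳ; -‿inverseˡ; -‿inverseʳ
    ; *-assoc; *-comm; *-identityˡ; *-identityʳ; distribˡ; zeroˡ; zeroʳ)
  open RingProperties (CommutativeRing.ring R) using (-1*x≈-x)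
  open GroupProperties (CommutativeRing.+-group R) using (ε⁻¹≈ε; ⁻¹-involutive; inverseˡ-unique)
  open CommutativeSemigroupProperties
    (CommutativeRing.+-commutativeSemigroup R) using (interchange)
  open CommutativeSemigroupProperties
    (CommutativeRing.*-commutativeSemigroup R) using (x∙yz≈y∙xz)

  q-nonZero : NonZero q
  q-nonZero = Fin.nonZeroIndex (Inverse.to enumeration 0#)

  -- Vectors, dot products and linear functionals.

  infixl 6 _⊕_
  infixr 7 _⊛_

  _⊕_ : ∀ {n} → Vec Carrier n → Vec Carrier n → Vec Carrier n
  _⊕_ = zipWith _+_

  _⊛_ : ∀ {n} → Carrier → Vec Carrier n → Vec Carrier n
  c ⊛ v = Vec.map (c ∙_) v

  ⊕-identityˡ : ∀ {n} (v : Vec Carrier n) → 0ᵛ ⊕ v ≡ v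
  ⊕-identityˡ = Vec.zipWith-identityˡ +-identityˡ

  ⊕-identityʳ : ∀ {n} (v : Vec Carrier n) → v ⊕ 0ᵛ ≡ v
  ⊕-identityʳ = Vec.zipWith-identityʳ +-identityʳ

  ⊛-zeroˡ : ∀ {n} (v : Vec Carrier n) → 0# ⊛ v ≡ 0ᵛ
  ⊛-zeroˡ v = trans (Vec.map-cong zeroˡ v) (Vec.map-const v 0#)

  ⊛-zeroʳ : ∀ {n} c → c ⊛ 0ᵛ {n} ≡ 0ᵛ
  ⊛-zeroʳ {n} c = trans (Vec.map-replicate (c ∙_) 0# n) (cong (replicate n) (zeroʳ c))

  -1⊛-inverseˡ : ∀ {n} (v : Vec Carrier n) → (- 1#) ⊛ v ⊕ v ≡ 0ᵛ
  -1⊛-inverseˡ []      = refl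
  -1⊛-inverseˡ (x ∷ v) =
    cong₂ _∷_ (trans (cong (_+ x) (-1*x≈-x x)) (-‿inverseˡ x)) (-1⊛-inverseˡ v)

  dot-comm : ∀ {n} (u v : Vec Carrier n) → dot u v ≡ dot v u
  dot-comm []      []      = refl
  dot-comm (x ∷ u) (y ∷ v) = cong₂ _+_ (*-comm x y) (dot-comm u v)

  dot-zeroʳ : ∀ {n} (u : Vec Carrier n) → dot u 0ᵛ ≡ 0#
  dot-zeroʳ []      = refl
  dot-zeroʳ (x ∷ u) = trans (cong₂ _+_ (zeroʳ x) (dot-zeroʳ u)) (+-identityˡ 0#)

  dot-distribˡ-⊕ : ∀ {n} (u v w : Vec Carrier n) → dot u (v ⊕ w) ≡ dot u v + dot u w
  dot-distribˡ-⊕ []      []      []      = sym (+-identityˡ 0#)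
  dot-distribˡ-⊕ (x ∷ u) (y ∷ v) (z ∷ w) =
    trans (cong₂ _+_ (distribˡ x y z) (dot-distribˡ-⊕ u v w))
      (interchange (x ∙ y) (x ∙ z) _ _)

  dot-⊛ʳ : ∀ {n} (u : Vec Carrier n) c v → dot u (c ⊛ v) ≡ c ∙ dot u v
  dot-⊛ʳ []      c []      = sym (zeroʳ c)
  dot-⊛ʳ (x ∷ u) c (y ∷ v) =
    trans (cong₂ _+_ (x∙yz≈y∙xz x c y) (dot-⊛ʳ u c v)) (sym (distribˡ c (x ∙ y) _))

  ·-⊕ : ∀ {t n} (A : Matrix t n) X Y → A · (X ⊕ Y) ≡ A · X ⊕ A · Y
  ·-⊕ []      X Y = refl
  ·-⊕ (a ∷ A) X Y = cong₂ _∷_ (dot-distribˡ-⊕ a X Y) (·-⊕ A X Y)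

  ·-⊛ : ∀ {t n} (A : Matrix t n) c X → A · (c ⊛ X) ≡ c ⊛ (A · X)
  ·-⊛ []      c X = refl
  ·-⊛ (a ∷ A) c X = cong₂ _∷_ (dot-⊛ʳ a c X) (·-⊛ A c X)

  -- Adjointness: `combination c A` is the transpose of `A` applied to `c`.
  dot-combination : ∀ {t n} c (A : Matrix t n) X → dot (combination c A) X ≡ dot c (A · X)
  dot-combination []       []      X = trans (dot-comm 0ᵛ X) (dot-zeroʳ X)
  dot-combination (c ∷ cs) (a ∷ A) X = begin
    dot (c ⊛ a ⊕ v) X            ≡⟨ dot-comm (c ⊛ a ⊕ v) X ⟩
    dot X (c ⊛ a ⊕ v)            ≡⟨ dot-distribˡ-⊕ X (c ⊛ a) v ⟩
    dot X (c ⊛ a) + dot X v      ≡⟨ cong₂ _+_ (dot-⊛ʳ X c a) (dot-comm X v) ⟩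
    c ∙ dot X a + dot v X        ≡⟨ cong₂ _+_ (cong (c ∙_) (dot-comm X a)) (dot-combination cs A X) ⟩
    c ∙ dot a X + dot cs (A · X) ∎
    where
    open ≡-Reasoning
    v = combination cs A

  -- The test vector `1# ∷ 0ᵛ` reads off the first coordinate, and the vectors `0# ∷ X` reduce the
  -- rest to the tails.
  dot-injective : ∀ {n} {u v : Vec Carrier n} → (∀ X → dot u X ≡ dot v X) → u ≡ v
  dot-injective {u = []}    {v = []}    _ = refl
  dot-injective {u = x ∷ u} {v = y ∷ v} u≗v =
    cong₂ _∷_ (trans (sym (head x u)) (trans (u≗v (1# ∷ 0ᵛ)) (head y v)))
      (dot-injective λ X → trans (sym (rest x u X)) (trans (u≗v (0# ∷ X)) (rest y v X)))
    where
    head : ∀ x u → x ∙ 1# + dot u 0ᵛ ≡ x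
    head x u = trans (cong₂ _+_ (*-identityʳ x) (dot-zeroʳ u)) (+-identityʳ x)
    rest : ∀ x u X → x ∙ 0# + dot u X ≡ dot u X
    rest x u X = trans (cong (_+ dot u X) (zeroʳ x)) (+-identityˡ _)

  -- The coefficients are the values of `φ` at the unit vectors.
  linear⇒dot : ∀ {n} (φ : Vec Carrier n → Carrier) →
               (∀ u v → φ (u ⊕ v) ≡ φ u + φ v) → (∀ c v → φ (c ⊛ v) ≡ c ∙ φ v) →
               ∃[ a ] ∀ v → φ v ≡ dot a v
  linear⇒dot {zero}  φ φ-⊕ φ-⊛ = [] , λ where
    -- In dimension 0 the only vector equals `0# ⊛ []`, so homogeneity forces the value 0.
    [] → trans (φ-⊛ 0# []) (zeroˡ _)
  linear⇒dot {suc n} φ φ-⊕ φ-⊛ = φ (1# ∷ 0ᵛ) ∷ proj₁ ih , λ where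
      (x ∷ v) → begin
        φ (x ∷ v)                          ≡⟨ cong φ (split x v) ⟩
        φ (x ⊛ (1# ∷ 0ᵛ) ⊕ (0# ∷ v))       ≡⟨ φ-⊕ _ _ ⟩
        φ (x ⊛ (1# ∷ 0ᵛ)) + φ (0# ∷ v)     ≡⟨ cong₂ _+_ (φ-⊛ x _) (proj₂ ih v) ⟩
        x ∙ φ (1# ∷ 0ᵛ) + dot (proj₁ ih) v ≡⟨ cong (_+ dot (proj₁ ih) v) (*-comm x _) ⟩
        φ (1# ∷ 0ᵛ) ∙ x + dot (proj₁ ih) v ∎
    where
    open ≡-Reasoning
    ih = linear⇒dot (φ ∘ (0# ∷_))
      (λ u v → trans (cong (λ x → φ (x ∷ u ⊕ v)) (sym (+-identityˡ 0#))) (φ-⊕ _ _))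
      (λ c v → trans (cong (λ x → φ (x ∷ c ⊛ v)) (sym (zeroʳ c))) (φ-⊛ c _))
    split : ∀ x v → x ∷ v ≡ x ⊛ (1# ∷ 0ᵛ) ⊕ (0# ∷ v)
    split x v = sym (cong₂ _∷_ (trans (+-identityʳ _) (*-identityʳ x))
      (trans (cong (_⊕ v) (⊛-zeroʳ x)) (⊕-identityˡ v)))

  -- Full row rank as solvability for every right-hand side.

  -- Full row rank in the form that the counting uses: it hands over the point X(b) for each b.
  Surjective· : ∀ {t n} → Matrix t n → Set
  Surjective· A = ∀ b → ∃[ X ] A · X ≡ b

  x-y≡0⇒x≡y : ∀ x y → x + (- 1#) ∙ y ≡ 0# → x ≡ y
  x-y≡0⇒x≡y x y eq = begin
    x                ≡⟨ inverseˡ-unique x _ eq ⟩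
    - ((- 1#) ∙ y)   ≡⟨ cong -_ (-1*x≈-x y) ⟩
    - - y            ≡⟨ ⁻¹-involutive y ⟩
    y                ∎
    where open ≡-Reasoning

  -- A row that vanishes on the kernel of B factors through B, and a linear
  -- functional on the range of B is a combination of coordinates.
  kernel⊆⇒InSpan : ∀ {t n} {B : Matrix t n} {a} → Surjective· B →
                   (∀ X → B · X ≡ 0ᵛ → dot a X ≡ 0#) → InSpan B a
  kernel⊆⇒InSpan {B = B} {a} B-surj ker⊆ = c , dot-injective λ X → begin
      dot (combination c B) X   ≡⟨ dot-combination c B X ⟩
      dot c (B · X)             ≡⟨ proj₂ representable (B · X) ⟨
      φ (B · X)                 ≡⟨ factor (B·section (B · X)) ⟩
      dot a X                   ∎
    where
    open ≡-Reasoning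
    section : ∀ b → Vec Carrier _
    section b = proj₁ (B-surj b)
    B·section : ∀ b → B · section b ≡ b
    B·section b = proj₂ (B-surj b)
    φ : Vec Carrier _ → Carrier
    φ b = dot a (section b)

    factor : ∀ {X Y} → B · X ≡ B · Y → dot a X ≡ dot a Y
    factor {X} {Y} BX≡BY = x-y≡0⇒x≡y (dot a X) (dot a Y) (begin
      dot a X + (- 1#) ∙ dot a Y      ≡⟨ +-comm _ _ ⟩
      (- 1#) ∙ dot a Y + dot a X      ≡⟨ cong (_+ dot a X) (dot-⊛ʳ a (- 1#) Y) ⟨
      dot a ((- 1#) ⊛ Y) + dot a X    ≡⟨ dot-distribˡ-⊕ a _ X ⟨
      dot a ((- 1#) ⊛ Y ⊕ X)          ≡⟨ ker⊆ _ (begin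
        B · ((- 1#) ⊛ Y ⊕ X)          ≡⟨ ·-⊕ B _ X ⟩
        B · ((- 1#) ⊛ Y) ⊕ B · X      ≡⟨ cong₂ _⊕_ (·-⊛ B (- 1#) Y) BX≡BY ⟩
        (- 1#) ⊛ (B · Y) ⊕ B · Y      ≡⟨ -1⊛-inverseˡ (B · Y) ⟩
        0ᵛ                            ∎) ⟩
      0#                              ∎)

    -- The chosen preimages need not depend linearly on b. By `factor`, `dot a` depends only on the
    -- image under `B`, and this makes `φ` linear.
    representable : ∃[ c ] ∀ b → φ b ≡ dot c b
    representable = linear⇒dot φ
      (λ b b′ → trans (factor (begin
         B · section (b ⊕ b′)              ≡⟨ B·section (b ⊕ b′) ⟩
         b ⊕ b′                            ≡⟨ cong₂ _⊕_ (B·section b) (B·section b′) ⟨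
         B · section b ⊕ B · section b′    ≡⟨ ·-⊕ B (section b) (section b′) ⟨
         B · (section b ⊕ section b′)      ∎))
         (dot-distribˡ-⊕ a (section b) (section b′)))
      (λ x b → trans (factor (begin
         B · section (x ⊛ b)     ≡⟨ B·section (x ⊛ b) ⟩
         x ⊛ b                   ≡⟨ cong (x ⊛_) (B·section b) ⟨
         x ⊛ (B · section b)     ≡⟨ ·-⊛ B x (section b) ⟨
         B · (x ⊛ section b)     ∎))
         (dot-⊛ʳ a x (section b)))
    c = proj₁ representable

  -- `#⇒invertible` inverts the difference x - 0, from which the zero has to be removed.
  inverse : ∀ {x} → x ≢ 0# → ∃[ y ] y ∙ x ≡ 1#
  inverse {x} x≢0 with y , yx≡1 , _ ← #⇒invertible x≢0 =
    y , trans (cong (y ∙_) (sym (trans (+-congˡ ε⁻¹≈ε) (+-identityʳ x)))) yx≡1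

  -- Because `a` is outside the span, some `Z` in the kernel of `B` has `dot a Z ≢ 0#`. Adding a
  -- multiple of `Z` to a solution of B X = b adjusts the new coordinate and leaves the others
  -- alone.
  Surjective·-∷ : ∀ {t n} {B : Matrix t n} {a} →
                  Surjective· B → ¬ InSpan B a → Surjective· (a ∷ B)
  Surjective·-∷ {B = B} {a} B-surj a∉B
    -- The search runs over finitely many vectors, so its failure yields the kernel inclusion
    -- constructively.
    with ∃? (λ Z → (B · Z ≟ᵛ 0ᵛ) ×-dec ¬? (dot a Z ≟ 0#))
  ... | no ¬∃Z = contradiction
    (kernel⊆⇒InSpan B-surj λ Z BZ≡0 →
      decidable-stable (dot a Z ≟ 0#) λ aZ≢0 → ¬∃Z (Z , BZ≡0 , aZ≢0))
    a∉B
  ... | yes (Z , BZ≡0 , aZ≢0) with d⁻¹ , d⁻¹d≡1 ← inverse aZ≢0 = solve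
    where
    open ≡-Reasoning
    solve : Surjective· (a ∷ B)
    solve (x ∷ b) with X , BX≡b ← B-surj b = X ⊕ s ⊛ Z , cong₂ _∷_
      (begin
        dot a (X ⊕ s ⊛ Z)               ≡⟨ dot-distribˡ-⊕ a X (s ⊛ Z) ⟩
        dot a X + dot a (s ⊛ Z)         ≡⟨ +-congˡ (dot-⊛ʳ a s Z) ⟩
        dot a X + s ∙ dot a Z           ≡⟨ +-congˡ (*-assoc _ d⁻¹ _) ⟩
        dot a X + (x + - dot a X) ∙ (d⁻¹ ∙ dot a Z)
          ≡⟨ cong (λ e → dot a X + (x + - dot a X) ∙ e) d⁻¹d≡1 ⟩
        dot a X + (x + - dot a X) ∙ 1#  ≡⟨ +-congˡ (*-identityʳ _) ⟩
        dot a X + (x + - dot a X)       ≡⟨ +-congˡ (+-comm x _) ⟩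
        dot a X + (- dot a X + x)       ≡⟨ +-assoc _ _ x ⟨
        dot a X + - dot a X + x         ≡⟨ cong (_+ x) (-‿inverseʳ _) ⟩
        0# + x                          ≡⟨ +-identityˡ x ⟩
        x                               ∎)
      (begin
        B · (X ⊕ s ⊛ Z)          ≡⟨ ·-⊕ B X (s ⊛ Z) ⟩
        B · X ⊕ B · (s ⊛ Z)      ≡⟨ cong₂ _⊕_ BX≡b (·-⊛ B s Z) ⟩
        b ⊕ s ⊛ (B · Z)          ≡⟨ cong (λ v → b ⊕ s ⊛ v) BZ≡0 ⟩
        b ⊕ s ⊛ 0ᵛ               ≡⟨ cong (b ⊕_) (⊛-zeroʳ s) ⟩
        b ⊕ 0ᵛ                   ≡⟨ ⊕-identityʳ b ⟩
        b                        ∎)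
      where
      s : Carrier
      s = (x + - dot a X) ∙ d⁻¹

  Surjective·-[] : ∀ {n} → Surjective· {n = n} []
  Surjective·-[] [] = 0ᵛ , refl

  -- Nontriviality comes out of the apartness axioms: if 0 = 1, then 0 - 1 equals 1 and is
  -- invertible, which makes 0 apart from 1.
  -1≢0 : - 1# ≢ 0#
  -1≢0 -1≡0 = IsHeytingField.#-irrefl isHeytingField 0≡1
    (IsHeytingField.invertible⇒# isHeytingField
      (1# , trans (*-identityˡ _) 0-1≡1 , trans (*-identityʳ _) 0-1≡1))
    where
    1≡0 : 1# ≡ 0#
    1≡0 = trans (sym (⁻¹-involutive 1#)) (trans (cong -_ -1≡0) ε⁻¹≈ε)
    0≡1 : 0# ≡ 1#
    0≡1 = sym 1≡0
    0-1≡1 : 0# + - 1# ≡ 1#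
    0-1≡1 = trans (+-identityˡ _) (trans -1≡0 0≡1)

  -- Rows are added from the bottom up. A relation among the lower rows extends by the coefficient
  -- 0, and a row in their span would give a relation with coefficient -1.
  LinearlyIndependent⇒Surjective· : ∀ {t n} (A : Matrix t n) →
                                    LinearlyIndependent A → Surjective· A
  LinearlyIndependent⇒Surjective· []      _       = Surjective·-[]
  LinearlyIndependent⇒Surjective· (a ∷ A) A-indep = Surjective·-∷
    (LinearlyIndependent⇒Surjective· A λ c cA≡0 → Vec.∷-injectiveʳ
      (A-indep (0# ∷ c) (trans (cong₂ _⊕_ (⊛-zeroˡ a) cA≡0) (⊕-identityˡ 0ᵛ))))
    λ (c , cA≡a) → -1≢0 (Vec.∷-injectiveˡ
      (A-indep (- 1# ∷ c) (trans (cong ((- 1#) ⊛ a ⊕_) cA≡a) (-1⊛-inverseˡ a))))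

  -- The injection selecting t independent rows out of t is a permutation, so it is enough to solve
  -- the permuted system.
  HasRank⇒Surjective· : ∀ {t n} (A : Matrix t n) → HasRank A t → Surjective· A
  HasRank⇒Surjective· {t} A ((s , s-injective , indep) , _) b = X , lookup-injective row
    where
    open ≡-Reasoning
    B = tabulate (lookup A ∘ s)
    solution = LinearlyIndependent⇒Surjective· B indep (tabulate (lookup b ∘ s))
    X = proj₁ solution

    lookup-injective : ∀ {u v : Vec Carrier t} → (∀ i → lookup u i ≡ lookup v i) → u ≡ v
    lookup-injective {u} {v} u≗v = trans (sym (Vec.tabulate∘lookup u))
      (trans (Vec.tabulate-cong u≗v) (Vec.tabulate∘lookup v))

    row : ∀ i → lookup (A · X) i ≡ lookup b i
    row i with j , refl ← injective⇒surjective s-injective i = begin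
      lookup (A · X) (s j)            ≡⟨ Vec.lookup-map (s j) _ A ⟩
      dot (lookup A (s j)) X          ≡⟨ cong (λ a → dot a X) (Vec.lookup∘tabulate _ j) ⟨
      dot (lookup B j) X              ≡⟨ Vec.lookup-map j _ B ⟨
      lookup (B · X) j                ≡⟨ cong (λ v → lookup v j) (proj₂ solution) ⟩
      lookup (tabulate (lookup b ∘ s)) j ≡⟨ Vec.lookup∘tabulate _ j ⟩
      lookup b (s j)                  ∎

  -- A row is retained only when it lies outside the span of the retained rows below, which is the
  -- hypothesis of `Surjective·-∷`.
  eliminate-Surjective· : ∀ {t n} (A : Matrix t n) → Surjective· (proj₂ (eliminate A))
  eliminate-Surjective· []      = Surjective·-[]
  eliminate-Surjective· (a ∷ A) with eliminate A | eliminate-Surjective· A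
  ... | r , B | B-surj with InSpan? B a
  ...   | yes _  = B-surj
  ...   | no a∉B = Surjective·-∷ B-surj a∉B

  eliminate-rows : ∀ {t n} (A : Matrix t n) → proj₁ (eliminate A) ≤ t
  eliminate-rows []      = z≤n
  eliminate-rows (a ∷ A) with eliminate A | eliminate-rows A
  ... | r , B | r≤t with InSpan? B a
  ...   | yes _ = ℕ.m≤n⇒m≤1+n r≤t
  ...   | no _  = s≤s r≤t

  -- Choosing preimages injects the `q ^ t` right-hand sides into the `q ^ n` vectors X.
  Surjective·⇒^≤^ : ∀ {t n} (A : Matrix t n) → Surjective· A → q ^ t ≤ q ^ n
  Surjective·⇒^≤^ {t} {n} A A-surj = Fin.injective⇒≤ {f = encode ∘ proj₁ ∘ A-surj ∘ decode}
    λ {i} {j} eq → decode-injective (begin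
      decode i                               ≡⟨ proj₂ (A-surj (decode i)) ⟨
      A · proj₁ (A-surj (decode i))          ≡⟨ cong (A ·_) (encode-injective eq) ⟩
      A · proj₁ (A-surj (decode j))          ≡⟨ proj₂ (A-surj (decode j)) ⟩
      decode j                               ∎)
    where
    open ≡-Reasoning
    open Inverse enumeration using (to; from; strictlyInverseˡ; strictlyInverseʳ)

    encode : ∀ {n} → Vec Carrier n → Fin (q ^ n)
    encode v = funToFin (to ∘ lookup v)

    decode : ∀ {n} → Fin (q ^ n) → Vec Carrier n
    decode {n} i = tabulate (from ∘ finToFun {q} {n} i)

    decode-encode : ∀ {n} (v : Vec Carrier n) → decode (encode v) ≡ v
    decode-encode v = trans
      (Vec.tabulate-cong λ i →
        trans (cong from (Fin.finToFun-funToFin (to ∘ lookup v) i)) (strictlyInverseʳ _))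
      (Vec.tabulate∘lookup v)

    -- The round trips recover functions only pointwise, so `funToFin` must respect pointwise
    -- equality.
    funToFin-cong : ∀ {m} {f g : Fin m → Fin q} → f ≗ g → funToFin f ≡ funToFin g
    funToFin-cong {zero}  f≗g = refl
    funToFin-cong {suc m} f≗g = cong₂ Fin.combine (f≗g zero) (funToFin-cong (f≗g ∘ suc))

    encode-decode : ∀ {n} (i : Fin (q ^ n)) → encode {n} (decode i) ≡ i
    encode-decode {n} i = trans
      (funToFin-cong λ j →
        trans (cong to (Vec.lookup∘tabulate _ j)) (strictlyInverseˡ (finToFun {q} {n} i j)))
      (Fin.funToFin-finToFin {n} {q} i)

    encode-injective : ∀ {n} {u v : Vec Carrier n} → encode u ≡ encode v → u ≡ v
    encode-injective {u = u} {v} eq =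
      trans (sym (decode-encode u)) (trans (cong decode eq) (decode-encode v))

    decode-injective : ∀ {n} {i j : Fin (q ^ n)} → decode {n} i ≡ decode j → i ≡ j
    decode-injective {n} {i} {j} eq =
      trans (sym (encode-decode {n} i)) (trans (cong encode eq) (encode-decode {n} j))

  -- Matrices and solutions of glued equations.

  module _ {n : ℕ} where

    -- The matrix side of gluing, computed from `A` alone. This makes the row count and the points
    -- X(b) visibly independent of the random polynomials.
    gluedMatrix : ∀ {m} {t : Fin m → ℕ} → (∀ i → Matrix (t i) n) → Fin m → ∃[ r ] Matrix r n
    gluedMatrix A zero    = _ , A zero
    gluedMatrix A (suc k) =
      eliminate (proj₂ (gluedMatrix (A ∘ inject₁) k) Vec.++ A (suc k))

    -- Bundling the row count allows matrices whose row counts agree only propositionally to be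
    -- compared.
    matrix : Equation n → ∃[ r ] Matrix r n
    matrix E = _ , Equation.A E

    matrix-glueUpTo : ∀ {m} (E : Fin m → Equation n) k →
                      matrix (glueUpTo E k) ≡ gluedMatrix (Equation.A ∘ E) k
    matrix-glueUpTo E zero    = refl
    matrix-glueUpTo E (suc k) =
      cong (λ (_ , B) → eliminate (B Vec.++ Equation.A (E (suc k))))
        (matrix-glueUpTo (E ∘ inject₁) k)

    gluedMatrix-Surjective· : ∀ {m} {t : Fin m → ℕ} (A : ∀ i → Matrix (t i) n) →
                              (∀ i → HasRank (A i) (t i)) →
                              ∀ k → Surjective· (proj₂ (gluedMatrix A k))
    gluedMatrix-Surjective· A rank zero    = HasRank⇒Surjective· (A zero) (rank zero)
    gluedMatrix-Surjective· A rank (suc k) = eliminate-Surjective·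
      (proj₂ (gluedMatrix (A ∘ inject₁) k) Vec.++ A (suc k))

    -- Each equation contributes at most `s` rows. Indices start at 0, so `k` stands for
    -- `suc (toℕ k)` equations.
    gluedMatrix-rows : ∀ {m s} {t : Fin m → ℕ} (A : ∀ i → Matrix (t i) n) →
                       (∀ i → t i ≤ s) →
                       ∀ k → proj₁ (gluedMatrix A k) ≤ suc (toℕ k) * s
    gluedMatrix-rows {s = s} {t} A t≤s zero    =
      ℕ.≤-trans (t≤s zero) (ℕ.≤-reflexive (sym (ℕ.*-identityˡ s)))
    gluedMatrix-rows {s = s} {t} A t≤s (suc k) = begin
      proj₁ (eliminate (B Vec.++ A (suc k)))   ≤⟨ eliminate-rows (B Vec.++ A (suc k)) ⟩
      r ℕ.+ t (suc k)                          ≤⟨ ℕ.+-mono-≤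
                                                    (gluedMatrix-rows (A ∘ inject₁) (t≤s ∘ inject₁) k)
                                                    (t≤s (suc k)) ⟩
      suc (toℕ k) * s ℕ.+ s                    ≡⟨ ℕ.+-comm _ s ⟩
      suc (suc (toℕ k)) * s                    ∎
      where
      open ℕ.≤-Reasoning
      r = proj₁ (gluedMatrix (A ∘ inject₁) k)
      B = proj₂ (gluedMatrix (A ∘ inject₁) k)

    -- With b = A X, the vector X solves the glued linear system, so the equivalence built into
    -- `glue` forces b₁ and b₂ to be the images of X under the two matrices.
    glueUpTo-sound : ∀ {m} (E : Fin m → Equation n) k X →
                     Equation.S (glueUpTo E k) (Equation.A (glueUpTo E k) · X) →
                     ∀ i → i Fin.≤ k → Equation.S (E i) (Equation.A (E i) · X)
    glueUpTo-sound E zero    X b∈S zero _ = b∈S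
    glueUpTo-sound E (suc k) X (b₁ , b₂ , b₁∈S , b₂∈S , equiv) i i≤k
      with ≤suc⇒inject₁⊎≡ i k i≤k | Equivalence.to (equiv X) refl
    ... | inj₁ (j , j≤k , refl) | refl , _    = glueUpTo-sound (E ∘ inject₁) k X b₁∈S j j≤k
    ... | inj₂ refl             | _    , refl = b₂∈S

  -- Zeros of random polynomials.

  length-elements : length elements ≡ q
  length-elements = trans (length-map (Inverse.from enumeration) (allFin q))
    (length-tabulate {n = q} _)

  elements-unique : Unique elements
  elements-unique = Unique.map⁺ from-injective (Unique.allFin⁺ q)
    where
    open Inverse enumeration
    from-injective : ∀ {i j} → from i ≡ from j → i ≡ j
    from-injective {i} {j} eq =
      trans (sym (strictlyInverseˡ i)) (trans (cong to eq) (strictlyInverseˡ j))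

  x+y≡z⇒x≡z-y : ∀ {x y z} → x + y ≡ z → x ≡ z + - y
  x+y≡z⇒x≡z-y {x} {y} {z} x+y≡z = begin
    x               ≡⟨ +-identityʳ x ⟨
    x + 0#          ≡⟨ +-congˡ (-‿inverseʳ y) ⟨
    x + (y + - y)   ≡⟨ +-assoc x y (- y) ⟨
    x + y + - y     ≡⟨ cong (_+ - y) x+y≡z ⟩
    z + - y         ∎
    where open ≡-Reasoning

  -- The values at a point are equidistributed: for every choice of the other
  -- coefficients, exactly one constant coefficient gives the value z.
  count-eval : ∀ t (ys : Vec Carrier t) z →
               sumOf (λ g → indicator (eval g ys ≟ z)) (polys t) * q ≤ length (polys t)
  count-eval zero    []       z = begin
    sumOf (λ c → indicator (c ≟ z)) elements * q
      ≤⟨ ℕ.*-monoˡ-≤ q (sumOf-indicator-unique (_≟ z)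
           (λ x≡z y≡z → trans x≡z (sym y≡z)) elements-unique) ⟩
    1 * q             ≡⟨ ℕ.*-identityˡ q ⟩
    q                 ≡⟨ length-elements ⟨
    length elements   ∎
    where open ℕ.≤-Reasoning
  count-eval (suc t) (y ∷ ys) z = count-horner q {{q-nonZero}}
    where
    open ℕ.≤-Reasoning
    horner : ∀ {p} → Vec (Poly t) p → Carrier
    horner = Vec.foldr′ (λ c acc → eval c ys + y ∙ acc) 0#

    -- The number of coefficients is generalised from `q` to any nonzero `p`, so that a constant
    -- coefficient can be split off.
    count-horner : ∀ p .{{_ : NonZero p}} →
      sumOf (λ g → indicator (horner g ≟ z)) (allVecs (polys t) p) * q ≤
      length (allVecs (polys t) p)
    count-horner (suc p) = begin
      sumOf (λ g → indicator (horner g ≟ z)) (cartesianProductWith _∷_ cs gs) * q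
        ≡⟨ cong (_* q) (sumOf-cartesianProductWith _∷_ _ cs gs) ⟩
      sumOf (λ c → sumOf (λ g → indicator (eval c ys + y ∙ horner g ≟ z)) gs) cs * q
        ≡⟨ cong (_* q) (sumOf-swap (λ c g → indicator (eval c ys + y ∙ horner g ≟ z)) cs gs) ⟩
      sumOf (λ g → sumOf (λ c → indicator (eval c ys + y ∙ horner g ≟ z)) cs) gs * q
        -- With the higher coefficients fixed, the constant one must take the shifted value
        -- `z + - (y ∙ horner g)`; this is why the induction is over all targets and not only 0.
        ≤⟨ sumOf-*-≤ (λ g → ℕ.≤-trans
             (ℕ.*-monoˡ-≤ q (sumOf-mono
               (λ c → indicator-mono (eval c ys + y ∙ horner g ≟ z)
                        (eval c ys ≟ z + - (y ∙ horner g)) x+y≡z⇒x≡z-y) cs))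
             (count-eval t ys (z + - (y ∙ horner g)))) gs ⟩
      length gs * length cs
        ≡⟨ ℕ.*-comm (length gs) (length cs) ⟩
      length cs * length gs
        ≡⟨ length-cartesianProductWith _∷_ cs gs ⟨
      length (cartesianProductWith _∷_ cs gs) ∎
      where
      cs = polys t
      gs = allVecs (polys t) p

  -- The indicator of joint vanishing, written as a product so that its total factorises. It
  -- recurses from the front, as `outcomes` does, whereas `glueUpTo` recurses from the back.
  vanishUpTo : ∀ {m} {t : Fin m → ℕ} → Fin m → (∀ i → Vec Carrier (t i)) →
               (∀ i → Poly (t i)) → ℕ
  vanishUpTo zero    y g = indicator (eval (g zero) (y zero) ≟ 0#)
  vanishUpTo (suc k) y g =
    indicator (eval (g zero) (y zero) ≟ 0#) * vanishUpTo k (y ∘ suc) (g ∘ suc)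

  1≤vanishUpTo : ∀ {m} {t : Fin m → ℕ} k (y : ∀ i → Vec Carrier (t i)) g →
                 (∀ i → i Fin.≤ k → eval (g i) (y i) ≡ 0#) → 1 ≤ vanishUpTo k y g
  1≤vanishUpTo zero    y g g≡0 = 1≤indicator _ (g≡0 zero z≤n)
  1≤vanishUpTo (suc k) y g g≡0 = ℕ.*-mono-≤ (1≤indicator (eval (g zero) (y zero) ≟ 0#) (g≡0 zero z≤n))
    (1≤vanishUpTo k (y ∘ suc) (g ∘ suc) λ i i≤k → g≡0 (suc i) (s≤s i≤k))

  -- Each of the k + 1 independent conditions at fixed points contributes a factor 1/q.
  count-vanishUpTo : ∀ {m} {t : Fin m → ℕ} k (y : ∀ i → Vec Carrier (t i)) →
    sumOf (vanishUpTo k y) (outcomes t) * q ^ suc (toℕ k) ≤ length (outcomes t)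
  count-vanishUpTo {t = t} zero    y = begin
    sumOf (vanishUpTo zero y) (cartesianProductWith cons ps os) * (q * 1)
      ≡⟨ cong₂ _*_ (sumOf-cartesianProductWith cons _ ps os) (ℕ.*-identityʳ q) ⟩
    sumOf (λ p → sumOf (λ _ → v p) os) ps * q
      -- The later polynomials are unconstrained here and only contribute the factor `length os`.
      ≡⟨ cong (_* q) (sumOf-swap (λ p _ → v p) ps os) ⟩
    sumOf (λ _ → sumOf v ps) os * q
      ≤⟨ sumOf-*-≤ (λ _ → count-eval _ (y zero) 0#) os ⟩
    length os * length ps
      ≡⟨ ℕ.*-comm (length os) (length ps) ⟩
    length ps * length os
      ≡⟨ length-cartesianProductWith cons ps os ⟨
    length (cartesianProductWith cons ps os) ∎
    where
    open ℕ.≤-Reasoning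
    cons = Fin.∀-cons {P = Poly ∘ t}
    ps = polys (t zero)
    os = outcomes (t ∘ suc)
    v : Poly (t zero) → ℕ
    v p = indicator (eval p (y zero) ≟ 0#)
  count-vanishUpTo {t = t} (suc k) y = begin
    sumOf (vanishUpTo (suc k) y) (cartesianProductWith cons ps os) * (q * q ^ suc (toℕ k))
      ≡⟨ cong (_* (q * q ^ suc (toℕ k))) (sumOf-cartesianProductWith cons _ ps os) ⟩
    sumOf (λ p → sumOf (λ g → v p * w g) os) ps * (q * q ^ suc (toℕ k))
      ≡⟨ cong (_* (q * q ^ suc (toℕ k))) (sumOf-product v w ps os) ⟩
    sumOf v ps * sumOf w os * (q * q ^ suc (toℕ k))
      ≡⟨ ℕ.[m*n]*[o*p]≡[m*o]*[n*p] (sumOf v ps) (sumOf w os) q _ ⟩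
    sumOf v ps * q * (sumOf w os * q ^ suc (toℕ k))
      ≤⟨ ℕ.*-mono-≤ (count-eval _ (y zero) 0#) (count-vanishUpTo k (y ∘ suc)) ⟩
    length ps * length os
      ≡⟨ length-cartesianProductWith cons ps os ⟨
    length (cartesianProductWith cons ps os) ∎
    where
    open ℕ.≤-Reasoning
    cons = Fin.∀-cons {P = Poly ∘ t}
    ps = polys (t zero)
    os = outcomes (t ∘ suc)
    v : Poly (t zero) → ℕ
    v p = indicator (eval p (y zero) ≟ 0#)
    w : (∀ i → Poly (t (suc i))) → ℕ
    w = vanishUpTo k (y ∘ suc)

  -- The average number of right-hand sides.

  module _ {m n : ℕ} {t : Fin m → ℕ} (A : ∀ i → Matrix (t i) n) where

    -- Each b in the right-hand side set is charged to its point X(b), where `w` is at least 1.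
    -- Passing `B` separately lets the points be chosen before `E`, hence before the polynomials.
    ∣S∣-≤ : ∀ (E : Equation n) {r} {B : Matrix r n} → matrix E ≡ (r , B) →
            (section : ∀ b → ∃[ X ] B · X ≡ b) (w : Vec Carrier n → ℕ) →
            (∀ X → Equation.S E (Equation.A E · X) → 1 ≤ w X) →
            Equation.∣S∣ E ≤ sumOf (w ∘ proj₁ ∘ section) (vectors r)
    ∣S∣-≤ E refl section w 1≤w = begin
      Equation.∣S∣ E
        ≡⟨ length-filter≡sumOf (Equation.S? E) (vectors _) ⟩
      sumOf (indicator ∘ Equation.S? E) (vectors _)
        ≤⟨ sumOf-mono (λ b → indicator-≤ (Equation.S? E b) λ b∈S →
             1≤w _ (subst (Equation.S E) (sym (proj₂ (section b))) b∈S)) (vectors _) ⟩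
      sumOf (w ∘ proj₁ ∘ section) (vectors _) ∎
      where open ℕ.≤-Reasoning

    -- Exchanging the sums over g and b is linearity of expectation: for a fixed b the points
    -- `point b` are fixed, and `count-vanishUpTo` applies.
    sumOf-gluedSize : (∀ i → HasRank (A i) (t i)) → ∀ k →
      sumOf (gluedSize A k) (outcomes t) * q ^ suc (toℕ k) ≤
      q ^ proj₁ (gluedMatrix A k) * length (outcomes t)
    sumOf-gluedSize rank k = begin
      sumOf (gluedSize A k) os * q ^ suc (toℕ k)
        ≤⟨ ℕ.*-monoˡ-≤ (q ^ suc (toℕ k)) (sumOf-mono gluedSize-≤ os) ⟩
      sumOf (λ g → sumOf (λ b → vanishUpTo k (point b) g) bs) os * q ^ suc (toℕ k)
        ≡⟨ cong (_* q ^ suc (toℕ k)) (sumOf-swap (λ g b → vanishUpTo k (point b) g) os bs) ⟩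
      sumOf (λ b → sumOf (vanishUpTo k (point b)) os) bs * q ^ suc (toℕ k)
        ≤⟨ sumOf-*-≤ (λ b → count-vanishUpTo k (point b)) bs ⟩
      length bs * length os
        ≡⟨ cong (_* length os) (trans (length-allVecs elements r) (cong (_^ r) length-elements)) ⟩
      q ^ r * length os ∎
      where
      open ℕ.≤-Reasoning
      os = outcomes t
      r = proj₁ (gluedMatrix A k)
      bs = vectors r
      section = gluedMatrix-Surjective· A rank k
      point : Vec Carrier r → ∀ i → Vec Carrier (t i)
      point b i = A i · proj₁ (section b)

      gluedSize-≤ : ∀ g → gluedSize A k g ≤ sumOf (λ b → vanishUpTo k (point b) g) bs
      gluedSize-≤ g = ∣S∣-≤ (glueUpTo E k) (matrix-glueUpTo E k) section
        (λ X → vanishUpTo k (λ i → A i · X) g)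
        λ X b∈S → 1≤vanishUpTo k (λ i → A i · X) g (glueUpTo-sound E k X b∈S)
        where
        E : Fin m → Equation n
        E i = zeroSetEquation (A i) (g i)

    averageComplexity-≤ : (∀ i → HasRank (A i) (t i)) →
      ∀ s .{{_ : NonZero s}} → (∀ i → t i ≤ s) →
      averageComplexity A ℚ.≤ + (m * q ^ (n ∸ ⌈ n / s ⌉)) ℚ./ 1
    averageComplexity-≤ rank s t≤s = ∑-≤ λ k →
      /-≤ (sumOf (gluedSize A k) os) N (length os) {{outcomes-nonZero t}}
        -- The factor q to the power k + 1 occurs on both sides of `bound` and is cancelled, being
        -- nonzero.
        (ℕ.*-cancelʳ-≤ _ _ (q ^ suc (toℕ k)) {{ℕ.m^n≢0 q (suc (toℕ k)) {{q-nonZero}}}} (bound k))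
      where
      open ℕ.≤-Reasoning
      os = outcomes t
      N = q ^ (n ∸ ⌈ n / s ⌉)
      bound : ∀ k → sumOf (gluedSize A k) os * q ^ suc (toℕ k) ≤
                    N * length os * q ^ suc (toℕ k)
      bound k = begin
        sumOf (gluedSize A k) os * q ^ suc (toℕ k)   ≤⟨ sumOf-gluedSize rank k ⟩
        q ^ proj₁ (gluedMatrix A k) * length os
          ≤⟨ ℕ.*-monoˡ-≤ (length os) (^-rank-bound q {{q-nonZero}} n s (suc (toℕ k))
               (gluedMatrix-rows A t≤s k)
               (Surjective·⇒^≤^ (proj₂ (gluedMatrix A k)) (gluedMatrix-Surjective· A rank k))) ⟩
        q ^ suc (toℕ k) * N * length os              ≡⟨ ℕ.*-assoc (q ^ suc (toℕ k)) N _ ⟩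
        q ^ suc (toℕ k) * (N * length os)            ≡⟨ ℕ.*-comm (q ^ suc (toℕ k)) _ ⟩
        N * length os * q ^ suc (toℕ k)              ∎

theorem3 : ∀ (t : ℕ) .{{_ : NonZero t}} →
    ∃[ C ] ∃[ n₀ ]
    (∀ {q} (F : FiniteField q) {n} → n₀ ≤ n →
    ∀ {m} {tᵢ : Fin m → ℕ} (A : ∀ i → MRHS.Matrix F (tᵢ i) n) →
    (∀ i → MRHS.HasRank F (A i) (tᵢ i)) →
    (∀ i → tᵢ i ≤ t) →
    MRHS.averageComplexity F A ℚ.≤ + (C * (m * q ^ (n ∸ ⌈ n / t ⌉))) ℚ./ 1)
-- The bound holds with constant 1, uniformly in q, and already from n = 0 on.
theorem3 t = 1 , 0 , λ {q} F {n} _ {m} A rank tᵢ≤t →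
  ℚ.≤-trans (averageComplexity-≤ F A rank t tᵢ≤t)
    (ℚ.≤-reflexive (cong (λ N → + N ℚ./ 1)
      (sym (ℕ.*-identityˡ (m * q ^ (n ∸ ⌈ n / t ⌉))))))
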